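{- For all integers $d\ge 1$ and $n\ge 1$, $$\mathsf{p}_d(n) \le n^d\,\mathsf{p}(\underbrace{n,\ldots,n}_{d\text{ times}}).$$
   Context: A $d$-dimensional partition is an array $\pi = (\pi_{i_1,\ldots,i_d})_{i_1,\ldots,i_d\ge 1}$ of nonnegative integers with only finitely many nonzero entries such that $\pi_{i_1,\ldots,i_d}\ge \pi_{j_1,\ldots,j_d}$ whenever $i_1\le j_1,\ldots,i_d\le j_d$. Its volume is $|\pi| = \sum_{i_1,\ldots,i_d}\pi_{i_1,\ldots,i_d}$. $\mathsf{p}_d(n)$ denotes the number of $d$-dimensional partitions of volume $n$. The vector partition numbers $\mathsf{p}(n_1,\ldots,n_d)$ (for nonnegative integers $n_1,\ldots,n_d$) are defined by the formal power series identity $$\sum_{n_1,\ldots,n_d\ge 0}\mathsf{p}(n_1,\ldots,n_d)\,x_1^{n_1}\cdots x_d^{n_d} = \prod_{i_1,\ldots,i_d\ge1}\left(1-x_1^{i_1}\cdots x_d^{i_d}\right)^{ -1}$$ (note that all exponents $i_1,\ldots,i_d$ in the product are at least $1$). -}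

module Defs where

open import Data.Bool.Base using (if_then_else_)
open import Data.Fin.Base as Fin using (Fin)
open import Data.Integer.Base as ℤ using (ℤ; +_; 0ℤ; 1ℤ)
import Data.Integer.Properties as ℤ
open import Data.Integer.Solver using (module +-*-Solver)
open import Data.List.Base as List
  using (List; []; _∷_; _++_; upTo; applyUpTo; cartesianProduct; cartesianProductWith; concatMap;
         filter; foldr; deduplicate; length)
import Data.List.Properties as List
open import Data.List.Membership.Propositional using (_∈_; _∉_)
open import Data.List.Membership.Propositional.Properties
  using (∈-upTo⁺; ∈-upTo⁻; ∈-cartesianProductWith⁺; ∈-cartesianProductWith⁻; ∈-cartesianProduct⁺; ∈-lookup)
import Data.List.Membership.Setoid as SetoidMembership
open import Data.List.Membership.Setoid.Properties using (∈-deduplicate⁺)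
open import Data.List.Relation.Unary.All as All using (All; []; _∷_)
import Data.List.Relation.Unary.All.Properties as All
open import Data.List.Relation.Unary.Any as Any using (Any; here; there; any?; index; satisfied)
import Data.List.Relation.Unary.Any.Properties as Any
open import Data.List.Relation.Unary.AllPairs using ([]; _∷_)
open import Data.List.Relation.Unary.Unique.Propositional using (Unique)
import Data.List.Relation.Unary.Unique.Propositional.Properties as Unique
import Data.List.Relation.Unary.Unique.Setoid as UniqueSetoid
open import Data.List.Relation.Unary.Unique.DecSetoid.Properties using (deduplicate-!)
open import Data.Nat.Base
  using (ℕ; zero; suc; _+_; _*_; _∸_; _≤_; _<_; z≤n; s≤s; s≤s⁻¹; _≤′_; ≤′-refl; ≤′-step; NonZero)
open import Data.Nat.ListAction using (sum)
open import Data.Nat.ListAction.Properties using (sum-++)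
open import Data.Nat.Properties as ℕ using (_≟_; _≤?_; _<?_)
open import Data.Product.Base using (Σ; ∃; _×_; _,_; proj₁; proj₂)
open import Data.Vec.Base as Vec using (Vec; []; _∷_; replicate; zipWith)
import Data.Vec.Properties as Vec
open import Data.Vec.Relation.Binary.Pointwise.Inductive as Pointwise using (Pointwise; []; _∷_)
open import Data.Vec.Relation.Unary.All as VAll using ([]; _∷_)
open import Function.Base using (_∘_; case_of_)
open import Function.Bundles using (Bijection)
open import Level using (0ℓ)
open import Relation.Binary.Bundles using (Setoid; DecSetoid)
open import Relation.Binary.Definitions using (DecidableEquality)
open import Relation.Binary.PropositionalEquality hiding (decSetoid; isEquivalence)
open import Relation.Nullary using (¬_; Dec; yes; no; does; contradiction)
open import Relation.Nullary.Decidable using (map′; _→-dec_)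

infix 4 _≼_ _≺_ _≼?_ _≺?_ _≟ᵛ_

_≼_ _≺_ : ∀ {d} → Vec ℕ d → Vec ℕ d → Set
_≼_ = Pointwise _≤_
_≺_ = Pointwise _<_

_≼?_ : ∀ {d} (i j : Vec ℕ d) → Dec (i ≼ j)
_≼?_ = Pointwise.decidable _≤?_

_≺?_ : ∀ {d} (i j : Vec ℕ d) → Dec (i ≺ j)
_≺?_ = Pointwise.decidable _<?_

_≟ᵛ_ : ∀ {d} → DecidableEquality (Vec ℕ d)
_≟ᵛ_ = Vec.≡-dec _≟_

-- All multi-indices i ≺ b, each listed once.
box : ∀ {d} → Vec ℕ d → List (Vec ℕ d)
box []       = [] ∷ []
box (b ∷ bs) = cartesianProductWith _∷_ (upTo b) (box bs)

sumBox : ∀ {d} → Vec ℕ d → (Vec ℕ d → ℕ) → ℕ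
sumBox b f = sum (List.map f (box b))

-- Arrays are indexed from 0: `entry (k₁ ∷ … ∷ k_d ∷ [])` is π_{k₁+1,…,k_d+1}.
record Partition (d : ℕ) : Set where
  field
    entry    : Vec ℕ d → ℕ
    antitone : ∀ {i j} → i ≼ j → entry j ≤ entry i
    bound    : Vec ℕ d
    finite   : ∀ i → entry i ≢ 0 → i ≺ bound

open Partition public

-- The entries outside the box are zero, so this does not depend on the choice of `bound`.
volume : ∀ {d} → Partition d → ℕ
volume π = sumBox (bound π) (entry π)

-- Partitions are identified when they are equal as arrays, whatever their `bound`.
PartitionsOfVolume : (d n : ℕ) → Setoid 0ℓ 0ℓ
PartitionsOfVolume d n = record
  { Carrier       = Σ (Partition d) λ π → volume π ≡ n
  ; _≈_           = λ π ρ → entry (proj₁ π) ≗ entry (proj₁ ρ)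
  ; isEquivalence = record
    { refl  = λ _ → refl
    ; sym   = λ e i → sym (e i)
    ; trans = λ e e′ i → trans (e i) (e′ i)
    }
  }

HasCardinality : Setoid 0ℓ 0ℓ → ℕ → Set
HasCardinality S k = Bijection (setoid (Fin k)) S

Series : ℕ → Set
Series d = Vec ℕ d → ℤ

sumℤ : List ℤ → ℤ
sumℤ = foldr ℤ._+_ 0ℤ

indicator : ∀ {P : Set} → Dec P → ℤ
indicator P? = if does P? then 1ℤ else 0ℤ

monomial : ∀ {d} → Vec ℕ d → Series d
monomial i k = indicator (k ≟ᵛ i)

one : ∀ {d} → Series d
one = monomial (replicate _ 0)

1-x^_ : ∀ {d} → Vec ℕ d → Series d
(1-x^ i) k = one k ℤ.- monomial i k

infixl 7 _⊛_

_⊛_ : ∀ {d} → Series d → Series d → Series d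
(f ⊛ g) m = sumℤ (List.map (λ k → f k ℤ.* g (zipWith _∸_ m k)) (box (Vec.map suc m)))

∏ : ∀ {d} → (Vec ℕ d → Series d) → List (Vec ℕ d) → Series d
∏ G is = foldr _⊛_ one (List.map G is)

-- All multi-indices i with 1 ≤ i_j ≤ b_j for every j.
positiveBox : ∀ {d} → Vec ℕ d → List (Vec ℕ d)
positiveBox b = List.map (Vec.map suc) (box b)

-- Convergence is coefficientwise: each coefficient is eventually constant along the boxes.
IsInfiniteProduct : ∀ {d} → (Vec ℕ d → Series d) → Series d → Set
IsInfiniteProduct {d} G P =
  ∀ m → ∃ λ (b₀ : Vec ℕ d) → ∀ b → b₀ ≼ b → ∏ G (positiveBox b) m ≡ P m

-- Σ p(m) x^m = ∏_{i ≥ 1} (1 - x^i)⁻¹, where G i is the (unique) inverse series (1 - x^i)⁻¹;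
-- hence there is at most one such p. For d = 0 there is none: the only factor is 1 - 1 = 0.
IsVectorPartitionFunction : ∀ {d} → (Vec ℕ d → ℕ) → Set
IsVectorPartitionFunction {d} p = ∃ λ (G : Vec ℕ d → Series d) →
  (∀ i → VAll.All (1 ≤_) i → (1-x^ i) ⊛ G i ≗ one) ×
  IsInfiniteProduct G (λ m → + p m)

∈-box⁺ : ∀ {d} {i b : Vec ℕ d} → i ≺ b → i ∈ box b
∈-box⁺ []        = here refl
∈-box⁺ (p ∷ ps) = ∈-cartesianProductWith⁺ _∷_ (∈-upTo⁺ p) (∈-box⁺ ps)

∈-box⁻ : ∀ {d} {i : Vec ℕ d} (b : Vec ℕ d) → i ∈ box b → i ≺ b
∈-box⁻ []       (here refl) = []
∈-box⁻ (b ∷ bs) i∈ with ∈-cartesianProductWith⁻ _∷_ (upTo b) (box bs) i∈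
... | _ , _ , p , q , refl = ∈-upTo⁻ p ∷ ∈-box⁻ bs q

box-unique : ∀ {d} (b : Vec ℕ d) → Unique (box b)
box-unique []       = [] ∷ []
box-unique (b ∷ bs) =
  Unique.cartesianProductWith⁺ _∷_ Vec.∷-injective (Unique.upTo⁺ b) (box-unique bs)

≼-refl : ∀ {d} {i : Vec ℕ d} → i ≼ i
≼-refl = Pointwise.refl ℕ.≤-refl

≼-trans : ∀ {d} {i j k : Vec ℕ d} → i ≼ j → j ≼ k → i ≼ k
≼-trans = Pointwise.trans ℕ.≤-trans

≼-≺-trans : ∀ {d} {i j k : Vec ℕ d} → i ≼ j → j ≺ k → i ≺ k
≼-≺-trans = Pointwise.trans ℕ.≤-<-trans

sumBox-∷ : ∀ {d} b (bs : Vec ℕ d) f →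
  sumBox (b ∷ bs) f ≡ sum (applyUpTo (λ k → sumBox bs (λ ks → f (k ∷ ks))) b)
sumBox-∷ b bs f = trans (go (upTo b)) (cong sum (List.map-upTo _ b))
  where
  open ≡-Reasoning
  go : ∀ ks → sum (List.map f (cartesianProductWith _∷_ ks (box bs))) ≡
              sum (List.map (λ k → sumBox bs (λ ks → f (k ∷ ks))) ks)
  go []       = refl
  go (k ∷ ks) = begin
    sum (List.map f (row ++ rest))              ≡⟨ cong sum (List.map-++ f row rest) ⟩
    sum (List.map f row ++ List.map f rest)     ≡⟨ sum-++ (List.map f row) (List.map f rest) ⟩
    sum (List.map f row) + sum (List.map f rest) ≡⟨ cong₂ _+_ (cong sum (sym (List.map-∘ (box bs)))) (go ks) ⟩
    sumBox bs (λ js → f (k ∷ js)) + _            ∎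
    where
    row  = List.map (k ∷_) (box bs)
    rest = cartesianProductWith _∷_ ks (box bs)

sum-applyUpTo-0 : ∀ (h : ℕ → ℕ) b → (∀ k → h k ≡ 0) → sum (applyUpTo h b) ≡ 0
sum-applyUpTo-0 h zero    h≡0 = refl
sum-applyUpTo-0 h (suc b) h≡0 = cong₂ _+_ (h≡0 0) (sum-applyUpTo-0 (h ∘ suc) b (h≡0 ∘ suc))

sum-applyUpTo-cong : ∀ {h h′ : ℕ → ℕ} b b′ → (∀ k → h k ≡ h′ k) →
  (∀ k → h k ≢ 0 → k < b) → (∀ k → h k ≢ 0 → k < b′) →
  sum (applyUpTo h b) ≡ sum (applyUpTo h′ b′)
sum-applyUpTo-cong {h} {h′} zero b′ e p p′ = sym (sum-applyUpTo-0 h′ b′ λ k →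
  trans (sym (e k)) (zero-outside k))
  where
  zero-outside : ∀ k → h k ≡ 0
  zero-outside k with h k ≟ 0
  ... | yes z = z
  ... | no nz = case p k nz of λ ()
sum-applyUpTo-cong {h} (suc b) zero e p p′ = sum-applyUpTo-0 h (suc b) zero-outside
  where
  zero-outside : ∀ k → h k ≡ 0
  zero-outside k with h k ≟ 0
  ... | yes z = z
  ... | no nz = case p′ k nz of λ ()
sum-applyUpTo-cong (suc b) (suc b′) e p p′ = cong₂ _+_ (e 0)
  (sum-applyUpTo-cong b b′ (e ∘ suc) (λ k → s≤s⁻¹ ∘ p (suc k)) (λ k → s≤s⁻¹ ∘ p′ (suc k)))

sumBox≢0 : ∀ {d} (b : Vec ℕ d) f → sumBox b f ≢ 0 → ∃ λ i → f i ≢ 0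
sumBox≢0 b f = go (box b)
  where
  go : ∀ is → sum (List.map f is) ≢ 0 → ∃ λ i → f i ≢ 0
  go []       nz = contradiction refl nz
  go (i ∷ is) nz with f i ≟ 0
  ... | no fi≢0  = i , fi≢0
  ... | yes fi≡0 = go is (λ z → nz (cong₂ _+_ fi≡0 z))

sumBox-cong : ∀ {d} (b b′ : Vec ℕ d) {f f′} → f ≗ f′ →
  (∀ i → f i ≢ 0 → i ≺ b) → (∀ i → f i ≢ 0 → i ≺ b′) → sumBox b f ≡ sumBox b′ f′
sumBox-cong []       []         e p p′ = cong (_+ 0) (e [])
sumBox-cong (b ∷ bs) (b′ ∷ bs′) {f} {f′} e p p′ = begin
  sumBox (b ∷ bs) f                                              ≡⟨ sumBox-∷ b bs f ⟩
  sum (applyUpTo (λ k → sumBox bs (λ ks → f (k ∷ ks))) b)        ≡⟨ sum-applyUpTo-cong b b′ rows inside inside′ ⟩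
  sum (applyUpTo (λ k → sumBox bs′ (λ ks → f′ (k ∷ ks))) b′)     ≡⟨ sumBox-∷ b′ bs′ f′ ⟨
  sumBox (b′ ∷ bs′) f′                                           ∎
  where
  open ≡-Reasoning
  rows : ∀ k → sumBox bs (λ ks → f (k ∷ ks)) ≡ sumBox bs′ (λ ks → f′ (k ∷ ks))
  rows k = sumBox-cong bs bs′ (λ ks → e (k ∷ ks))
    (λ ks nz → Pointwise.tail (p (k ∷ ks) nz)) (λ ks nz → Pointwise.tail (p′ (k ∷ ks) nz))
  inside : ∀ k → sumBox bs (λ ks → f (k ∷ ks)) ≢ 0 → k < b
  inside k nz with ks , fk≢0 ← sumBox≢0 bs _ nz = Pointwise.head (p (k ∷ ks) fk≢0)
  inside′ : ∀ k → sumBox bs (λ ks → f (k ∷ ks)) ≢ 0 → k < b′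
  inside′ k nz with ks , fk≢0 ← sumBox≢0 bs _ nz = Pointwise.head (p′ (k ∷ ks) fk≢0)

≤-sum-applyUpTo : ∀ (h : ℕ → ℕ) {b k} → k < b → h k ≤ sum (applyUpTo h b)
≤-sum-applyUpTo h {suc b} {zero}  _   = ℕ.m≤m+n _ _
≤-sum-applyUpTo h {suc b} {suc k} k<b =
  ℕ.≤-trans (≤-sum-applyUpTo (h ∘ suc) (s≤s⁻¹ k<b)) (ℕ.m≤n+m _ _)

<-sum-applyUpTo : ∀ (h : ℕ → ℕ) {b k} → k < b → (∀ j → j ≤ k → 1 ≤ h j) →
                  k < sum (applyUpTo h b)
<-sum-applyUpTo h {suc b} {zero}  _   pos = ℕ.≤-trans (pos 0 z≤n) (ℕ.m≤m+n _ _)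
<-sum-applyUpTo h {suc b} {suc k} k<b pos =
  ℕ.+-mono-≤ (pos 0 z≤n) (<-sum-applyUpTo (h ∘ suc) (s≤s⁻¹ k<b) (λ j → pos (suc j) ∘ s≤s))

≤-sumBox : ∀ {d} (b : Vec ℕ d) f {i} → i ≺ b → f i ≤ sumBox b f
≤-sumBox []       f []       = ℕ.m≤m+n _ _
≤-sumBox (b ∷ bs) f (p ∷ ps) = subst (_ ≤_) (sym (sumBox-∷ b bs f))
  (ℕ.≤-trans (≤-sumBox bs _ ps) (≤-sum-applyUpTo _ p))

≺-sumBox : ∀ {d} (b : Vec ℕ d) f → (∀ {i j} → i ≼ j → f j ≤ f i) →
           ∀ {i} → i ≺ b → 1 ≤ f i → Pointwise (λ k _ → k < sumBox b f) i b
≺-sumBox []       f anti []       _ = []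
≺-sumBox (b ∷ bs) f anti {i ∷ is} (p ∷ ps) fi≥1 rewrite sumBox-∷ b bs f =
  <-sum-applyUpTo _ p
    (λ j j≤i → ℕ.≤-trans (ℕ.≤-trans fi≥1 (anti (j≤i ∷ ≼-refl))) (≤-sumBox bs _ ps))
  ∷ Pointwise.map (λ k<s → ℕ.<-≤-trans k<s (≤-sum-applyUpTo _ p))
      (≺-sumBox bs _ (λ i≼j → anti (ℕ.≤-refl ∷ i≼j)) ps fi≥1)

finite-by-volume : ∀ {d} (π : Partition d) i → entry π i ≢ 0 → i ≺ replicate d (volume π)
finite-by-volume π i nz =
  widen (≺-sumBox (bound π) (entry π) (antitone π) (finite π i nz) (ℕ.n≢0⇒n>0 nz))
  where
  widen : ∀ {d n} {i b : Vec ℕ d} → Pointwise (λ k _ → k < n) i b → i ≺ replicate d n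
  widen []       = []
  widen (p ∷ ps) = p ∷ widen ps

entry≤volume : ∀ {d} (π : Partition d) i → entry π i ≤ volume π
entry≤volume π i with entry π i ≟ 0
... | yes z = subst (_≤ volume π) (sym z) z≤n
... | no nz = ≤-sumBox (bound π) (entry π) (finite π i nz)

module Enumeration (d n : ℕ) where

  open Setoid (PartitionsOfVolume d n) using (Carrier; _≈_; isEquivalence)
  corner : Vec ℕ d
  corner = replicate d n

  _≈?_ : (π ρ : Carrier) → Dec (π ≈ ρ)
  (π , vπ) ≈? (ρ , vρ) = map′ everywhere (λ e → All.tabulate (λ {i} _ → e i))
    (All.all? (λ i → entry π i ≟ entry ρ i) (box corner))
    where
    outside : ∀ σ → volume σ ≡ n → ∀ i → ¬ i ≺ corner → entry σ i ≡ 0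
    outside σ refl i i⊀ with entry σ i ≟ 0
    ... | yes z = z
    ... | no nz = contradiction (finite-by-volume σ i nz) i⊀
    everywhere : All (λ i → entry π i ≡ entry ρ i) (box corner) → entry π ≗ entry ρ
    everywhere all i with i ≺? corner
    ... | yes i≺ = All.lookup all (∈-box⁺ i≺)
    ... | no  i⊀ = trans (outside π vπ i i⊀) (sym (outside ρ vρ i i⊀))

  decSetoid : DecSetoid 0ℓ 0ℓ
  decSetoid = record
    { Carrier          = Carrier
    ; _≈_              = _≈_
    ; isDecEquivalence = record { isEquivalence = isEquivalence ; _≟_ = _≈?_ }
    }

  update : Vec ℕ d → ℕ → (Vec ℕ d → ℕ) → Vec ℕ d → ℕ
  update k v f i = if does (i ≟ᵛ k) then v else f i

  tables : List (Vec ℕ d) → List (Vec ℕ d → ℕ)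
  tables []       = (λ _ → 0) ∷ []
  tables (k ∷ ks) = cartesianProductWith (update k) (upTo (suc n)) (tables ks)

  tables-complete : ∀ (f : Vec ℕ d → ℕ) → (∀ i → f i ≤ n) → ∀ ks →
    ∃ λ g → g ∈ tables ks × (∀ {i} → i ∈ ks → g i ≡ f i)
  tables-complete f f≤n []       = _ , here refl , λ ()
  tables-complete f f≤n (k ∷ ks) with g , g∈ , e ← tables-complete f f≤n ks =
    update k (f k) g , ∈-cartesianProductWith⁺ update′ (∈-upTo⁺ (s≤s (f≤n k))) g∈ , agrees
    where
    update′ = update k
    agrees : ∀ {i} → i ∈ k ∷ ks → update k (f k) g i ≡ f i
    agrees {i} i∈ with i ≟ᵛ k
    ... | yes refl = refl
    ... | no i≢k with i∈
    ...   | here i≡k  = contradiction i≡k i≢k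
    ...   | there i∈′ = e i∈′

  cut : (Vec ℕ d → ℕ) → Vec ℕ d → ℕ
  cut g i = if does (i ≺? corner) then g i else 0

  cut-finite : ∀ g i → cut g i ≢ 0 → i ≺ corner
  cut-finite g i nz with i ≺? corner
  ... | yes i≺ = i≺
  ... | no  _  = contradiction refl nz

  AntitoneAt : (Vec ℕ d → ℕ) → Vec ℕ d × Vec ℕ d → Set
  AntitoneAt f (i , j) = i ≼ j → f j ≤ f i

  antitoneAt? : ∀ f ij → Dec (AntitoneAt f ij)
  antitoneAt? f (i , j) = (i ≼? j) →-dec (f j ≤? f i)

  pairs : List (Vec ℕ d × Vec ℕ d)
  pairs = cartesianProduct (box corner) (box corner)

  antitone-cut : ∀ g → All (AntitoneAt (cut g)) pairs → ∀ {i j} → i ≼ j → cut g j ≤ cut g i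
  antitone-cut g all {i} {j} i≼j with cut g j ≟ 0
  ... | yes z = subst (_≤ cut g i) (sym z) z≤n
  ... | no nz = All.lookup all
    (∈-cartesianProduct⁺ (∈-box⁺ (≼-≺-trans i≼j j≺)) (∈-box⁺ j≺)) i≼j
    where j≺ = cut-finite g j nz

  fromTable : (Vec ℕ d → ℕ) → List Carrier
  fromTable g with All.all? (antitoneAt? (cut g)) pairs | sumBox corner (cut g) ≟ n
  ... | yes all | yes v = (record
          { entry = cut g ; antitone = antitone-cut g all ; bound = corner ; finite = cut-finite g } , v) ∷ []
  ... | yes _   | no _  = []
  ... | no _    | _     = []

  fromTable-complete : ∀ g (π : Carrier) → cut g ≗ entry (proj₁ π) → Any (π ≈_) (fromTable g)
  fromTable-complete g (π , refl) e
    with All.all? (antitoneAt? (cut g)) pairs | sumBox corner (cut g) ≟ n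
  ... | yes _ | yes _ = here (λ i → sym (e i))
  ... | yes _ | no ¬v = contradiction
    (sumBox-cong corner (bound π) e (cut-finite g)
      (λ i nz → finite π i (λ z → nz (trans (e i) z)))) ¬v
  ... | no ¬a | _     = contradiction
    (All.tabulate λ {ij} _ i≼j →
      subst₂ _≤_ (sym (e (proj₂ ij))) (sym (e (proj₁ ij))) (antitone π i≼j)) ¬a

  allPartitions : List Carrier
  allPartitions = concatMap fromTable (tables (box corner))

  module M = SetoidMembership (PartitionsOfVolume d n)

  allPartitions-complete : ∀ π → π M.∈ allPartitions
  allPartitions-complete (π , refl)
    with g , g∈ , e ← tables-complete (entry π) (entry≤volume π) (box corner) =
    Any.concatMap⁺ fromTable (Any.map (λ { refl → fromTable-complete g (π , refl) cut-g }) g∈)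
    where
    cut-g : cut g ≗ entry π
    cut-g i with i ≺? corner
    ... | yes i≺ = e (∈-box⁺ i≺)
    ... | no  i⊀ with entry π i ≟ 0
    ...   | yes z = sym z
    ...   | no nz = contradiction (finite-by-volume π i nz) i⊀

  distinctPartitions : List Carrier
  distinctPartitions = deduplicate _≈?_ allPartitions

  distinctPartitions-complete : ∀ π → π M.∈ distinctPartitions
  distinctPartitions-complete π = ∈-deduplicate⁺ (PartitionsOfVolume d n) _≈?_
    (λ z≈y x≈y i → trans (x≈y i) (sym (z≈y i))) {z = π} (allPartitions-complete π)

  lookup-injective : ∀ {xs} → UniqueSetoid.Unique (PartitionsOfVolume d n) xs →
    ∀ {i j} → List.lookup xs i ≈ List.lookup xs j → i ≡ j
  lookup-injective (_  ∷ _) {Fin.zero}  {Fin.zero}  _ = refl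
  lookup-injective (x≉ ∷ _) {Fin.zero}  {Fin.suc j} e = contradiction e (All.lookup x≉ (∈-lookup j))
  lookup-injective (x≉ ∷ _) {Fin.suc i} {Fin.zero}  e =
    contradiction (λ k → sym (e k)) (All.lookup x≉ (∈-lookup i))
  lookup-injective (_  ∷ u) {Fin.suc i} {Fin.suc j} e = cong Fin.suc (lookup-injective u e)

  partitions-finite : HasCardinality (PartitionsOfVolume d n) (length distinctPartitions)
  partitions-finite = record
    { to        = List.lookup distinctPartitions
    ; cong      = λ { refl _ → refl }
    ; bijective = lookup-injective (deduplicate-! decSetoid allPartitions)
                , λ π → index (distinctPartitions-complete π) , λ { refl i →
                    sym (Any.lookup-index (distinctPartitions-complete π) i) }
    }

partitions-finite : ∀ d n → ∃ (HasCardinality (PartitionsOfVolume d n))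
partitions-finite d n = _ , Enumeration.partitions-finite d n

partitionNumber : (d n : ℕ) → ℕ
partitionNumber d n = proj₁ (partitions-finite d n)

sumℤ-cong : ∀ {A : Set} {f g : A → ℤ} {xs} → (∀ {x} → x ∈ xs → f x ≡ g x) →
  sumℤ (List.map f xs) ≡ sumℤ (List.map g xs)
sumℤ-cong e = cong sumℤ (List.map-cong-local (All.tabulate e))

sumℤ-0 : ∀ {A : Set} {f : A → ℤ} {xs} → (∀ {x} → x ∈ xs → f x ≡ 0ℤ) → sumℤ (List.map f xs) ≡ 0ℤ
sumℤ-0 {xs = []}     e = refl
sumℤ-0 {xs = x ∷ xs} e = cong₂ ℤ._+_ (e (here refl)) (sumℤ-0 (e ∘ there))

sumℤ-difference : ∀ {A : Set} (f g h : A → ℤ) xs →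
  sumℤ (List.map (λ x → (f x ℤ.- g x) ℤ.* h x) xs) ≡
  sumℤ (List.map (λ x → f x ℤ.* h x) xs) ℤ.- sumℤ (List.map (λ x → g x ℤ.* h x) xs)
sumℤ-difference f g h []       = refl
sumℤ-difference f g h (x ∷ xs)
  rewrite sumℤ-difference f g h xs =
  solve 5 (λ a b c s t → (a :- b) :* c :+ (s :- t) := (a :* c :+ s) :- (b :* c :+ t)) refl
    (f x) (g x) (h x) _ _
  where open +-*-Solver

indicator-true : ∀ {P : Set} (P? : Dec P) → P → indicator P? ≡ 1ℤ
indicator-true (yes _) _ = refl
indicator-true (no ¬p) p = contradiction p ¬p

indicator-false : ∀ {P : Set} (P? : Dec P) → ¬ P → indicator P? ≡ 0ℤ
indicator-false (yes p) ¬p = contradiction p ¬p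
indicator-false (no _)  _  = refl

indicator-cong : ∀ {P Q : Set} (P? : Dec P) (Q? : Dec Q) → (P → Q) → (Q → P) →
  indicator P? ≡ indicator Q?
indicator-cong (yes p) Q? to from = sym (indicator-true Q? (to p))
indicator-cong (no ¬p) Q? to from = sym (indicator-false Q? (¬p ∘ from))

sum-monomial-∉ : ∀ {d} {i : Vec ℕ d} (h : Vec ℕ d → ℤ) {ks} → i ∉ ks →
  sumℤ (List.map (λ k → monomial i k ℤ.* h k) ks) ≡ 0ℤ
sum-monomial-∉ {i = i} h i∉ = sumℤ-0 λ {k} k∈ →
  cong (ℤ._* h k) (indicator-false (k ≟ᵛ i) λ { refl → i∉ k∈ })

sum-monomial-∈ : ∀ {d} {i : Vec ℕ d} (h : Vec ℕ d → ℤ) {ks} → Unique ks → i ∈ ks →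
  sumℤ (List.map (λ k → monomial i k ℤ.* h k) ks) ≡ h i
sum-monomial-∈ {i = i} h {i ∷ ks} (i≢ ∷ _) (here refl)
  rewrite indicator-true (i ≟ᵛ i) refl
        | sum-monomial-∉ {i = i} h {ks} (λ i∈ → All.lookup i≢ i∈ refl)
        = trans (ℤ.+-identityʳ _) (ℤ.*-identityˡ _)
sum-monomial-∈ {i = i} h {k ∷ ks} (k≢ ∷ u) (there i∈)
  rewrite indicator-false (k ≟ᵛ i) (All.lookup k≢ i∈)
        = trans (ℤ.+-identityˡ _) (sum-monomial-∈ h u i∈)

≼⇒≺suc : ∀ {d} {k m : Vec ℕ d} → k ≼ m → k ≺ Vec.map suc m
≼⇒≺suc []       = []
≼⇒≺suc (p ∷ ps) = s≤s p ∷ ≼⇒≺suc ps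

≺suc⇒≼ : ∀ {d} {k} (m : Vec ℕ d) → k ≺ Vec.map suc m → k ≼ m
≺suc⇒≼ []      []       = []
≺suc⇒≼ (m ∷ ms) (p ∷ ps) = s≤s⁻¹ p ∷ ≺suc⇒≼ ms ps

0≼ : ∀ {d} (m : Vec ℕ d) → replicate d 0 ≼ m
0≼ []       = []
0≼ (m ∷ ms) = z≤n ∷ 0≼ ms

∸-0 : ∀ {d} (m : Vec ℕ d) → zipWith _∸_ m (replicate d 0) ≡ m
∸-0 []       = refl
∸-0 (m ∷ ms) = cong (m ∷_) (∸-0 ms)

∸-≼ : ∀ {d} (m k : Vec ℕ d) → zipWith _∸_ m k ≼ m
∸-≼ []       []       = []
∸-≼ (m ∷ ms) (k ∷ ks) = ℕ.m∸n≤m m k ∷ ∸-≼ ms ks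

monomial-⊛-≼ : ∀ {d} {i m : Vec ℕ d} (g : Series d) → i ≼ m →
  (monomial i ⊛ g) m ≡ g (zipWith _∸_ m i)
monomial-⊛-≼ {m = m} g i≼m =
  sum-monomial-∈ (λ k → g (zipWith _∸_ m k)) (box-unique (Vec.map suc m)) (∈-box⁺ (≼⇒≺suc i≼m))

monomial-⊛-⋠ : ∀ {d} {i m : Vec ℕ d} (g : Series d) → ¬ i ≼ m → (monomial i ⊛ g) m ≡ 0ℤ
monomial-⊛-⋠ {m = m} g i⋠m = sum-monomial-∉ (λ k → g (zipWith _∸_ m k))
  (λ i∈ → i⋠m (≺suc⇒≼ m (∈-box⁻ (Vec.map suc m) i∈)))

one-⊛ : ∀ {d} (g : Series d) → one ⊛ g ≗ g
one-⊛ g m = trans (monomial-⊛-≼ g (0≼ m)) (cong g (∸-0 m))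

-- Σ_c x^{c i}
IsMultiple : ∀ {d} → Vec ℕ d → Vec ℕ d → Set
IsMultiple i k = Any (λ c → k ≡ Vec.map (c *_) i) (upTo (suc (Vec.sum k)))

geometric : ∀ {d} → Vec ℕ d → Series d
geometric i k = indicator (any? (λ c → k ≟ᵛ Vec.map (c *_) i) (upTo (suc (Vec.sum k))))

multiple⁺ : ∀ {d} .{{_ : NonZero d}} {i : Vec ℕ d} → VAll.All (1 ≤_) i →
  ∀ c {k} → k ≡ Vec.map (c *_) i → IsMultiple i k
multiple⁺ {i = suc a ∷ as} (_ ∷ _) c refl =
  Any.map (λ { refl → refl }) (∈-upTo⁺ (s≤s (ℕ.≤-trans (ℕ.m≤m*n c (suc a)) (ℕ.m≤m+n _ _))))

suc-multiple⁺ : ∀ {d} c {i m : Vec ℕ d} → i ≼ m → zipWith _∸_ m i ≡ Vec.map (c *_) i →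
  m ≡ Vec.map (suc c *_) i
suc-multiple⁺ c []       e = refl
suc-multiple⁺ c {i ∷ _} (p ∷ ps) e = cong₂ _∷_
  (trans (sym (ℕ.m+[n∸m]≡n p)) (cong (λ r → i + r) (Vec.∷-injectiveˡ e)))
  (suc-multiple⁺ c ps (Vec.∷-injectiveʳ e))

suc-multiple⁻ : ∀ {d} c {i m : Vec ℕ d} → m ≡ Vec.map (suc c *_) i →
  i ≼ m × zipWith _∸_ m i ≡ Vec.map (c *_) i
suc-multiple⁻ c {[]}     {[]}     e    = [] , refl
suc-multiple⁻ c {i ∷ is} {_ ∷ ms} e with refl ← Vec.∷-injectiveˡ e
  with ps , es ← suc-multiple⁻ c {is} (Vec.∷-injectiveʳ e) =
  ℕ.m≤m+n i _ ∷ ps , cong₂ _∷_ (ℕ.m+n∸m≡n i _) es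

0-multiple : ∀ {d} (i : Vec ℕ d) → Vec.map (0 *_) i ≡ replicate d 0
0-multiple []       = refl
0-multiple (_ ∷ is) = cong (0 ∷_) (0-multiple is)

positive⋠0 : ∀ {d} .{{_ : NonZero d}} {i : Vec ℕ d} → VAll.All (1 ≤_) i → ¬ i ≼ replicate d 0
positive⋠0 (s≤s _ ∷ _) (() ∷ _)

geometric-⋠ : ∀ {d} .{{_ : NonZero d}} {i m : Vec ℕ d} → VAll.All (1 ≤_) i → ¬ i ≼ m →
  geometric i m ≡ one m
geometric-⋠ {d} {i} {m} pos i⋠m = indicator-cong (any? _ _) (m ≟ᵛ replicate d 0) to from
  where
  to : IsMultiple i m → m ≡ replicate d 0
  to c·i with satisfied c·i
  ... | zero  , e = trans e (0-multiple i)
  ... | suc c , e = contradiction (proj₁ (suc-multiple⁻ c e)) i⋠m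
  from : m ≡ replicate d 0 → IsMultiple i m
  from e = multiple⁺ pos 0 (trans e (sym (0-multiple i)))

geometric-≼ : ∀ {d} .{{_ : NonZero d}} {i m : Vec ℕ d} → VAll.All (1 ≤_) i → i ≼ m →
  geometric i m ≡ geometric i (zipWith _∸_ m i)
geometric-≼ {i = i} {m} pos i≼m = indicator-cong (any? _ _) (any? _ _) to from
  where
  to : IsMultiple i m → IsMultiple i (zipWith _∸_ m i)
  to c·i with satisfied c·i
  ... | zero  , e = contradiction (subst (i ≼_) (trans e (0-multiple i)) i≼m) (positive⋠0 pos)
  ... | suc c , e = multiple⁺ pos c (proj₂ (suc-multiple⁻ c e))
  from : IsMultiple i (zipWith _∸_ m i) → IsMultiple i m
  from c·i with c , e ← satisfied c·i = multiple⁺ pos (suc c) (suc-multiple⁺ c i≼m e)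

geometric-inverse : ∀ {d} .{{_ : NonZero d}} (i : Vec ℕ d) → VAll.All (1 ≤_) i →
  (1-x^ i) ⊛ geometric i ≗ one
geometric-inverse {d} i pos m = begin
  ((1-x^ i) ⊛ geometric i) m                             ≡⟨ sumℤ-difference one (monomial i) (λ k → geometric i (zipWith _∸_ m k)) (box (Vec.map suc m)) ⟩
  (one ⊛ geometric i) m ℤ.- (monomial i ⊛ geometric i) m ≡⟨ cong (ℤ._- (monomial i ⊛ geometric i) m) (one-⊛ (geometric i) m) ⟩
  geometric i m ℤ.- (monomial i ⊛ geometric i) m         ≡⟨ cases ⟩
  one m                                                  ∎
  where
  open ≡-Reasoning
  cases : geometric i m ℤ.- (monomial i ⊛ geometric i) m ≡ one m
  cases with i ≼? m
  ... | no i⋠m rewrite monomial-⊛-⋠ (geometric i) i⋠m | geometric-⋠ pos i⋠m = ℤ.+-identityʳ _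
  ... | yes i≼m rewrite monomial-⊛-≼ (geometric i) i≼m | geometric-≼ pos i≼m =
    trans (ℤ.+-inverseʳ (geometric i (zipWith _∸_ m i)))
      (sym (indicator-false (m ≟ᵛ replicate d 0) λ { refl → positive⋠0 pos i≼m }))

infix 4 _≈[_]_

_≈[_]_ : ∀ {d} → Series d → Vec ℕ d → Series d → Set
f ≈[ m ] g = ∀ k → k ≼ m → f k ≡ g k

⊛-cong : ∀ {d} {m : Vec ℕ d} {f f′ g g′ : Series d} →
  f ≈[ m ] f′ → g ≈[ m ] g′ → f ⊛ g ≈[ m ] f′ ⊛ g′
⊛-cong ef eg k k≼m = sumℤ-cong λ {j} j∈ → cong₂ ℤ._*_
  (ef j (≼-trans (≺suc⇒≼ k (∈-box⁻ (Vec.map suc k) j∈)) k≼m))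
  (eg _ (≼-trans (∸-≼ k j) k≼m))

∏-filter : ∀ {d} .{{_ : NonZero d}} (m : Vec ℕ d) {is} → All (VAll.All (1 ≤_)) is →
  ∏ geometric is ≈[ m ] ∏ geometric (filter (_≼? m) is)
∏-filter m []           k k≼m = refl
∏-filter m {i ∷ is} (pos ∷ poss) k k≼m with i ≼? m
... | yes _  = ⊛-cong {f = geometric i} (λ _ _ → refl) (∏-filter m poss) k k≼m
... | no i⋠m = trans
  (⊛-cong {f = geometric i} {one} {∏ geometric is}
    (λ j j≼m → geometric-⋠ pos (λ i≼j → i⋠m (≼-trans i≼j j≼m))) (∏-filter m poss) k k≼m)
  (one-⊛ (∏ geometric (filter (_≼? m) is)) k)

filter-upTo : ∀ {m b} → m ≤′ b → filter (_<? m) (upTo b) ≡ upTo m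
filter-upTo {m} ≤′-refl = List.filter-all (_<? m) (All.tabulate ∈-upTo⁻)
filter-upTo {m} {suc b} (≤′-step m≤b) = begin
  filter (_<? m) (upTo (suc b))                         ≡⟨ cong (filter (_<? m)) (List.upTo-∷ʳ b) ⟨
  filter (_<? m) (upTo b List.∷ʳ b)                     ≡⟨ List.filter-++ (_<? m) (upTo b) (b ∷ []) ⟩
  filter (_<? m) (upTo b) ++ filter (_<? m) (b ∷ [])    ≡⟨ cong₂ _++_ (filter-upTo m≤b) (List.filter-reject (_<? m) (ℕ.≤⇒≯ (ℕ.≤′⇒≤ m≤b))) ⟩
  upTo m ++ []                                          ≡⟨ List.++-identityʳ (upTo m) ⟩
  upTo m                                                ∎
  where open ≡-Reasoning

filter-row : ∀ {d} {m k} {ms : Vec ℕ d} → k < m → ∀ kss →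
  filter (_≺? (m ∷ ms)) (List.map (k ∷_) kss) ≡ List.map (k ∷_) (filter (_≺? ms) kss)
filter-row p [] = refl
filter-row {m = m} {k} {ms} p (ks ∷ kss) = case ks ≺? ms of λ where
  (yes ps) → trans (List.filter-accept (_≺? (m ∷ ms)) (p ∷ ps))
    (trans (cong ((k ∷ ks) ∷_) (filter-row p kss))
      (cong (List.map (k ∷_)) (sym (List.filter-accept (_≺? ms) ps))))
  (no ¬ps) → trans (List.filter-reject (_≺? (m ∷ ms)) (¬ps ∘ Pointwise.tail))
    (trans (filter-row p kss) (cong (List.map (k ∷_)) (sym (List.filter-reject (_≺? ms) ¬ps))))

filter-cartesian : ∀ {d} m (ms : Vec ℕ d) xs ys →
  filter (_≺? (m ∷ ms)) (cartesianProductWith _∷_ xs ys) ≡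
  cartesianProductWith _∷_ (filter (_<? m) xs) (filter (_≺? ms) ys)
filter-cartesian m ms []       ys = refl
filter-cartesian m ms (x ∷ xs) ys
  rewrite List.filter-++ (_≺? (m ∷ ms)) (List.map (x ∷_) ys) (cartesianProductWith _∷_ xs ys)
        | filter-cartesian m ms xs ys
  with x <? m
... | yes p rewrite filter-row {ms = ms} p ys | List.filter-accept (_<? m) {xs = xs} p = refl
... | no ¬p rewrite List.filter-reject (_<? m) {xs = xs} ¬p =
  cong (_++ cartesianProductWith _∷_ (filter (_<? m) xs) (filter (_≺? ms) ys))
    (List.filter-none (_≺? (m ∷ ms)) {xs = List.map (x ∷_) ys} (All.map⁺ (All.tabulate λ _ → ¬p ∘ Pointwise.head)))

filter-box : ∀ {d} {m b : Vec ℕ d} → m ≼ b → filter (_≺? m) (box b) ≡ box m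
filter-box []                               = refl
filter-box {m = m ∷ ms} {b ∷ bs} (p ∷ ps) = trans (filter-cartesian m ms (upTo b) (box bs))
  (cong₂ (cartesianProductWith _∷_) (filter-upTo (ℕ.≤⇒≤′ p)) (filter-box ps))

suc≼⇒≺ : ∀ {d} {k : Vec ℕ d} (m : Vec ℕ d) → Vec.map suc k ≼ m → k ≺ m
suc≼⇒≺ {k = []}    []       []       = []
suc≼⇒≺ {k = _ ∷ _} (m ∷ ms) (p ∷ ps) = p ∷ suc≼⇒≺ ms ps

≺⇒suc≼ : ∀ {d} {k m : Vec ℕ d} → k ≺ m → Vec.map suc k ≼ m
≺⇒suc≼ []       = []
≺⇒suc≼ (p ∷ ps) = p ∷ ≺⇒suc≼ ps

filter-positiveBox : ∀ {d} {m b : Vec ℕ d} → m ≼ b →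
  filter (_≼? m) (positiveBox b) ≡ positiveBox m
filter-positiveBox {m = m} {b} m≼b =
  trans (go (box b)) (cong (List.map (Vec.map suc)) (filter-box m≼b))
  where
  go : ∀ ks → filter (_≼? m) (List.map (Vec.map suc) ks) ≡
              List.map (Vec.map suc) (filter (_≺? m) ks)
  go []       = refl
  go (k ∷ ks) with k ≺? m
  ... | yes p = trans (List.filter-accept (_≼? m) (≺⇒suc≼ p)) (cong (_ ∷_) (go ks))
  ... | no ¬p = trans (List.filter-reject (_≼? m) (¬p ∘ suc≼⇒≺ m)) (go ks)

positiveBox-positive : ∀ {d} (b : Vec ℕ d) → All (VAll.All (1 ≤_)) (positiveBox b)
positiveBox-positive b = All.map⁺ (All.tabulate λ {k} _ → suc-positive k)
  where
  suc-positive : ∀ {d} (k : Vec ℕ d) → VAll.All (1 ≤_) (Vec.map suc k)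
  suc-positive []       = []
  suc-positive (_ ∷ ks) = s≤s z≤n ∷ suc-positive ks

indicator-nonNeg : ∀ {P : Set} (P? : Dec P) → 0ℤ ℤ.≤ indicator P?
indicator-nonNeg (yes _) = ℤ.+≤+ z≤n
indicator-nonNeg (no _)  = ℤ.+≤+ z≤n

sumℤ-nonNeg : ∀ {A : Set} (f : A → ℤ) xs → (∀ x → 0ℤ ℤ.≤ f x) → 0ℤ ℤ.≤ sumℤ (List.map f xs)
sumℤ-nonNeg f []       f≥0 = ℤ.≤-refl
sumℤ-nonNeg f (x ∷ xs) f≥0 = ℤ.+-mono-≤ (f≥0 x) (sumℤ-nonNeg f xs f≥0)

*-nonNeg : ∀ {x y} → 0ℤ ℤ.≤ x → 0ℤ ℤ.≤ y → 0ℤ ℤ.≤ x ℤ.* y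
*-nonNeg {+ a} {+ b} _ _ = subst (0ℤ ℤ.≤_) (ℤ.pos-* a b) (ℤ.+≤+ z≤n)

∏-nonNeg : ∀ {d} (is : List (Vec ℕ d)) m → 0ℤ ℤ.≤ ∏ geometric is m
∏-nonNeg []       m = indicator-nonNeg (m ≟ᵛ _)
∏-nonNeg (i ∷ is) m = sumℤ-nonNeg _ (box (Vec.map suc m)) λ k →
  *-nonNeg (indicator-nonNeg (any? (λ c → k ≟ᵛ Vec.map (c *_) i) (upTo (suc (Vec.sum k)))))
           (∏-nonNeg is (zipWith _∸_ m k))

vectorPartitionFunction : ∀ d .{{_ : NonZero d}} → ∃ (IsVectorPartitionFunction {d})
vectorPartitionFunction d = p , geometric , geometric-inverse , λ m → m , λ b m≼b → begin
  ∏ geometric (positiveBox b) m                      ≡⟨ ∏-filter m (positiveBox-positive b) m ≼-refl ⟩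
  ∏ geometric (filter (_≼? m) (positiveBox b)) m     ≡⟨ cong (λ is → ∏ geometric is m) (filter-positiveBox m≼b) ⟩
  ∏ geometric (positiveBox m) m                      ≡⟨ ℤ.0≤i⇒+∣i∣≡i (∏-nonNeg (positiveBox m) m) ⟨
  + p m                                              ∎
  where
  open ≡-Reasoning
  p : Vec ℕ d → ℕ
  p m = ℤ.∣ ∏ geometric (positiveBox m) m ∣

vectorPartitionNumber : ∀ {d} .{{_ : NonZero d}} → Vec ℕ d → ℕ
vectorPartitionNumber {d} = proj₁ (vectorPartitionFunction d)

{-# OPTIONS --safe #-}

-- Put a_i = π_i − max_k π_{i+e_k} (inverse last-passage percolation). The array a ≥ 0 determines π,
-- and summation by parts applied to a_i ≤ π_i − π_{i+e_k} gives m_k = Σ_i i_k a_i ≤ |π| = n for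
-- every k, with m_k ≥ 1 as π ≠ 0. Reading a as the multiset containing the vector i exactly a_i
-- times, π becomes a vector partition of m. Adding r = (n,…,n) − m to its lexicographically largest
-- part v yields a vector partition of (n,…,n) whose largest part is v + r, so this step can be undone
-- when r is known. There are n^d possible values of r, since 0 ≤ r_k < n.
module Submission where

open import Defs
open import Data.Bool.Base using (if_then_else_)
open import Data.Fin.Base using (Fin; zero; suc)
open import Data.Fin.Properties using (injective⇒≤)
open import Data.Integer.Base as ℤ using (+_)
import Data.Integer.Properties as ℤ
open import Data.List.Base as List
  using (List; []; _∷_; upTo; applyUpTo; cartesianProduct; cartesianProductWith; concatMap;
         filter; foldr; length)
import Data.List.Extrema as Extrema
open import Data.List.Membership.Propositional using (_∈_; lose)
open import Data.List.Membership.Propositional.Properties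
  using (∈-cartesianProduct⁺; ∈-concatMap⁺; ∈-filter⁺; ∈-map⁺)
open import Data.List.Membership.Setoid.Properties using (index-injective)
import Data.List.Properties as List
open import Data.List.Relation.Unary.All as All using (All; []; _∷_)
import Data.List.Relation.Unary.All.Properties as All
open import Data.List.Relation.Unary.AllPairs using ([]; _∷_)
open import Data.List.Relation.Unary.Any using (here; there; any?; index; satisfied)
open import Data.List.Relation.Unary.Unique.Propositional using (Unique)
open import Data.Nat.Base
open import Data.Nat.ListAction using (sum)
open import Data.Nat.Properties as ℕ using (_≟_)
open import Data.Nat.Tactic.RingSolver using (solve-∀)
open import Data.Product.Base using (∃; _×_; _,_; proj₁; proj₂)
open import Data.Sum.Base using (_⊎_; inj₁; inj₂)
open import Data.Vec.Base as Vec using (Vec; []; _∷_; lookup; replicate; updateAt; zipWith)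
import Data.Vec.Properties as Vec
import Data.Vec.Relation.Binary.Lex.NonStrict as Lex
import Data.Vec.Relation.Binary.Pointwise.Extensional as Extensional
open import Data.Vec.Relation.Binary.Pointwise.Inductive as Pointwise using (Pointwise; []; _∷_)
open import Data.Vec.Relation.Unary.All as VAll using ([]; _∷_)
open import Function.Base using (_∘_; id)
open import Function.Bundles using (Bijection)
open import Level using (0ℓ)
open import Relation.Binary.Bundles using (Setoid; TotalOrder)
open import Relation.Binary.PropositionalEquality
open import Relation.Nullary using (Dec; yes; no; does; contradiction)
open import Relation.Nullary.Decidable using (¬?)

-- Componentwise addition and finite sums

infixl 6 _⊕_

_⊕_ : ∀ {d} → Vec ℕ d → Vec ℕ d → Vec ℕ d
_⊕_ = zipWith _+_

⊕-cancelʳ : ∀ {d} {v w : Vec ℕ d} r → v ⊕ r ≡ w ⊕ r → v ≡ w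
⊕-cancelʳ {v = []}     {[]}     []       e = refl
⊕-cancelʳ {v = _ ∷ _} {_ ∷ _} (x ∷ r) e = cong₂ _∷_
  (ℕ.+-cancelʳ-≡ x _ _ (Vec.∷-injectiveˡ e)) (⊕-cancelʳ r (Vec.∷-injectiveʳ e))

v≼v⊕r : ∀ {d} (v r : Vec ℕ d) → v ≼ v ⊕ r
v≼v⊕r []       []       = []
v≼v⊕r (x ∷ v) (y ∷ r) = ℕ.m≤m+n x y ∷ v≼v⊕r v r

⊕-∸-cancelˡ : ∀ {d} (v r : Vec ℕ d) → zipWith _∸_ (v ⊕ r) v ≡ r
⊕-∸-cancelˡ []       []       = refl
⊕-∸-cancelˡ (x ∷ v) (y ∷ r) = cong₂ _∷_ (ℕ.m+n∸m≡n x y) (⊕-∸-cancelˡ v r)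

map-suc-⊕ : ∀ {d} (v r : Vec ℕ d) → Vec.map suc (v ⊕ r) ≡ Vec.map suc v ⊕ r
map-suc-⊕ []       []       = refl
map-suc-⊕ (x ∷ v) (y ∷ r) = cong (_ ∷_) (map-suc-⊕ v r)

Pointwise⁺ : ∀ {d} {R : ℕ → ℕ → Set} {v w : Vec ℕ d} →
  (∀ k → R (lookup v k) (lookup w k)) → Pointwise R v w
Pointwise⁺ p = Extensional.extensional⇒inductive (Extensional.ext p)

≼⇒sum≤ : ∀ {d} {v w : Vec ℕ d} → v ≼ w → Vec.sum v ≤ Vec.sum w
≼⇒sum≤ []       = z≤n
≼⇒sum≤ (p ∷ ps) = ℕ.+-mono-≤ p (≼⇒sum≤ ps)

module _ {A : Set} where

  open ≡-Reasoning

  sum-map-+ : ∀ (f g : A → ℕ) xs →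
    sum (List.map (λ x → f x + g x) xs) ≡ sum (List.map f xs) + sum (List.map g xs)
  sum-map-+ f g []       = refl
  sum-map-+ f g (x ∷ xs) rewrite sum-map-+ f g xs = interchange (f x) (g x) _ _
    where
    interchange : ∀ a b c d → a + b + (c + d) ≡ a + c + (b + d)
    interchange = solve-∀

  sum-map-*ʳ : ∀ (f : A → ℕ) c xs → sum (List.map (λ x → f x * c) xs) ≡ sum (List.map f xs) * c
  sum-map-*ʳ f c []       = refl
  sum-map-*ʳ f c (x ∷ xs) rewrite sum-map-*ʳ f c xs = sym (ℕ.*-distribʳ-+ c (f x) _)

  sum-map-mono : ∀ {f g : A → ℕ} xs → (∀ x → f x ≤ g x) →
    sum (List.map f xs) ≤ sum (List.map g xs)
  sum-map-mono []       f≤g = z≤n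
  sum-map-mono (x ∷ xs) f≤g = ℕ.+-mono-≤ (f≤g x) (sum-map-mono xs f≤g)

  sum-map-0 : ∀ {f : A → ℕ} {xs} → All (λ x → f x ≡ 0) xs → sum (List.map f xs) ≡ 0
  sum-map-0 []       = refl
  sum-map-0 (p ∷ ps) = cong₂ _+_ p (sum-map-0 ps)

sum-applyUpTo-mono : ∀ {h h′ : ℕ → ℕ} b → (∀ x → h x ≤ h′ x) →
  sum (applyUpTo h b) ≤ sum (applyUpTo h′ b)
sum-applyUpTo-mono zero    h≤h′ = z≤n
sum-applyUpTo-mono (suc b) h≤h′ = ℕ.+-mono-≤ (h≤h′ 0) (sum-applyUpTo-mono b (h≤h′ ∘ suc))

-- Summation by parts

-- Since `a x` is at most the drop of `f` at `x` and `w` grows by one per step, regrouping leaves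
-- `f 0 * w 0` and one copy of each later value; the term at the far end has the right sign to be
-- dropped. The initial value of `w` is left free so that the induction can shift all three
-- sequences.
summation-by-parts : ∀ (a f w : ℕ → ℕ) → (∀ x → a x + f (suc x) ≤ f x) →
  (∀ x → w (suc x) ≡ suc (w x)) → ∀ b →
  sum (applyUpTo (λ x → a x * w x) (suc b)) ≤ f 0 * w 0 + sum (applyUpTo (f ∘ suc) b)
summation-by-parts a f w a+f≤f w-suc zero =
  ℕ.+-monoˡ-≤ 0 (ℕ.*-monoˡ-≤ (w 0) (ℕ.≤-trans (ℕ.m≤m+n (a 0) (f 1)) (a+f≤f 0)))
summation-by-parts a f w a+f≤f w-suc (suc b) = begin
  a 0 * w 0 + sum (applyUpTo (λ x → a (suc x) * w (suc x)) (suc b))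
    ≤⟨ ℕ.+-monoʳ-≤ (a 0 * w 0)
         (summation-by-parts (a ∘ suc) (f ∘ suc) (w ∘ suc)
           (λ x → a+f≤f (suc x)) (λ x → w-suc (suc x)) b) ⟩
  a 0 * w 0 + (f 1 * w 1 + s)
    ≡⟨ cong (λ u → a 0 * w 0 + (f 1 * u + s)) (w-suc 0) ⟩
  a 0 * w 0 + (f 1 * suc (w 0) + s)
    ≡⟨ regroup (a 0) (f 1) (w 0) s ⟩
  (a 0 + f 1) * w 0 + (f 1 + s)
    ≤⟨ ℕ.+-monoˡ-≤ (f 1 + s) (ℕ.*-monoˡ-≤ (w 0) (a+f≤f 0)) ⟩
  f 0 * w 0 + (f 1 + s) ∎
  where
  open ℕ.≤-Reasoning
  s = sum (applyUpTo (λ x → f (suc (suc x))) b)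
  regroup : ∀ a f w s → a * w + (f * suc w + s) ≡ (a + f) * w + (f + s)
  regroup = solve-∀

-- Only coordinate `k` is summed by parts. If it is the first, the slice sums satisfy the
-- one-dimensional hypothesis; otherwise each slice is treated by induction.
sumBox-by-parts : ∀ {d} (b : Vec ℕ d) (k : Fin d) {a f : Vec ℕ d → ℕ} →
  (∀ i → a i + f (updateAt i k suc) ≤ f i) →
  sumBox b (λ i → a i * lookup (Vec.map suc i) k) ≤ sumBox b f
sumBox-by-parts (b ∷ bs) zero {a} {f} a+f≤f = begin
  sumBox (b ∷ bs) (λ i → a i * lookup (Vec.map suc i) zero) ≡⟨ sumBox-∷ b bs _ ⟩
  sum (applyUpTo (λ x → sumBox bs (λ xs → a (x ∷ xs) * suc x)) b)
    ≤⟨ sum-applyUpTo-mono b (λ x → ℕ.≤-reflexive (sum-map-*ʳ _ (suc x) (box bs))) ⟩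
  sum (applyUpTo (λ x → slice a x * suc x) b) ≤⟨ rows b ⟩
  sum (applyUpTo (slice f) b)                 ≡⟨ sumBox-∷ b bs f ⟨
  sumBox (b ∷ bs) f                           ∎
  where
  open ℕ.≤-Reasoning
  slice : (Vec ℕ _ → ℕ) → ℕ → ℕ
  slice g x = sumBox bs (λ xs → g (x ∷ xs))
  slice-≤ : ∀ x → slice a x + slice f (suc x) ≤ slice f x
  slice-≤ x = ℕ.≤-trans (ℕ.≤-reflexive (sym (sum-map-+ _ _ (box bs))))
    (sum-map-mono (box bs) (λ xs → a+f≤f (x ∷ xs)))
  rows : ∀ b → sum (applyUpTo (λ x → slice a x * suc x) b) ≤ sum (applyUpTo (slice f) b)
  rows zero    = z≤n
  -- The weight starts at 1, so the boundary term is exactly the first slice of `f`.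
  rows (suc b) = ℕ.≤-trans (summation-by-parts (slice a) (slice f) suc slice-≤ (λ _ → refl) b)
    (ℕ.≤-reflexive (cong (λ s → s + sum (applyUpTo (slice f ∘ suc) b)) (ℕ.*-identityʳ (slice f 0))))
sumBox-by-parts (b ∷ bs) (suc k) {a} {f} a+f≤f = begin
  sumBox (b ∷ bs) (λ i → a i * lookup (Vec.map suc i) (suc k)) ≡⟨ sumBox-∷ b bs _ ⟩
  sum (applyUpTo (λ x → sumBox bs (λ xs → a (x ∷ xs) * lookup (Vec.map suc xs) k)) b)
    ≤⟨ sum-applyUpTo-mono b (λ x → sumBox-by-parts bs k (λ xs → a+f≤f (x ∷ xs))) ⟩
  sum (applyUpTo (λ x → sumBox bs (λ xs → f (x ∷ xs))) b) ≡⟨ sumBox-∷ b bs f ⟨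
  sumBox (b ∷ bs) f ∎
  where open ℕ.≤-Reasoning

-- Unit masses

δ : ∀ {d} → Vec ℕ d → Vec ℕ d → ℕ
δ v u = if does (u ≟ᵛ v) then 1 else 0

δ-diagonal : ∀ {d} (v : Vec ℕ d) → δ v v ≡ 1
δ-diagonal v with v ≟ᵛ v
... | yes _  = refl
... | no v≢v = contradiction refl v≢v

δ-off : ∀ {d} {v u : Vec ℕ d} → u ≢ v → δ v u ≡ 0
δ-off {v = v} {u} u≢v with u ≟ᵛ v
... | yes u≡v = contradiction u≡v u≢v
... | no _    = refl

sumBox-δ : ∀ {d} {b v : Vec ℕ d} (g : Vec ℕ d → ℕ) → v ≺ b → sumBox b (λ u → δ v u * g u) ≡ g v
sumBox-δ {b = b} {v} g v≺b = go (box-unique b) (∈-box⁺ v≺b)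
  where
  go : ∀ {us} → Unique us → v ∈ us → sum (List.map (λ u → δ v u * g u) us) ≡ g v
  go {u ∷ us} (u≢ ∷ _) (here refl) rewrite δ-diagonal v = trans
    (cong (λ s → g v + 0 + s) (sum-map-0 (All.map (λ v≢w → cong (_* g _) (δ-off (v≢w ∘ sym))) u≢)))
    (trans (ℕ.+-identityʳ _) (ℕ.+-identityʳ _))
  go {u ∷ us} (u≢ ∷ uniq) (there v∈) rewrite δ-off {v = v} (All.lookup u≢ v∈) = go uniq v∈

-- Last-passage percolation

-- next f i = max_k f(i + e_k)
next : ∀ {d} → (Vec ℕ d → ℕ) → Vec ℕ d → ℕ
next f []       = 0
next f (x ∷ xs) = f (suc x ∷ xs) ⊔ next (λ ys → f (x ∷ ys)) xs

-- The array `a` of the overview; the subtraction is exact for antitone `f`, by `next-≤`.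
peak : ∀ {d} → (Vec ℕ d → ℕ) → Vec ℕ d → ℕ
peak f i = f i ∸ next f i

next-≤ : ∀ {d} {f : Vec ℕ d → ℕ} → (∀ {i j} → i ≼ j → f j ≤ f i) → ∀ i → next f i ≤ f i
next-≤ anti []       = z≤n
next-≤ anti (x ∷ xs) = ℕ.⊔-lub (anti (ℕ.n≤1+n x ∷ ≼-refl)) (next-≤ (λ p → anti (ℕ.≤-refl ∷ p)) xs)

step≤next : ∀ {d} (f : Vec ℕ d → ℕ) i k → f (updateAt i k suc) ≤ next f i
step≤next f (x ∷ xs) zero    = ℕ.m≤m⊔n _ _
step≤next f (x ∷ xs) (suc k) = ℕ.≤-trans (step≤next (λ ys → f (x ∷ ys)) xs k) (ℕ.m≤n⊔m _ _)

-- The neighbours `i + e_k` all have coordinate sum one larger, which makes a recursion by levels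
-- possible.
next-cong : ∀ {d} {f g : Vec ℕ d → ℕ} i → (∀ j → Vec.sum j ≡ suc (Vec.sum i) → f j ≡ g j) →
  next f i ≡ next g i
next-cong []       e = refl
next-cong (x ∷ xs) e = cong₂ _⊔_ (e (suc x ∷ xs) refl)
  (next-cong xs λ ys p → e (x ∷ ys) (trans (cong (λ s → x + s) p) (ℕ.+-suc x _)))

-- Downward induction on the coordinate sum, using `f i = peak f i + next f i`, from level `N` on
-- where both arrays agree.
peak-determines : ∀ {d} {f g : Vec ℕ d → ℕ} N → (∀ i → N ≤ Vec.sum i → f i ≡ g i) →
  (∀ i → next f i ≤ f i) → (∀ i → next g i ≤ g i) → peak f ≗ peak g → f ≗ g
peak-determines {f = f} {g} N far nf≤f ng≤g e i = go N i (ℕ.m≤m+n N _)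
  where
  open ≡-Reasoning
  -- `t` bounds the number of levels from `i` up to `N`.
  go : ∀ t i → N ≤ t + Vec.sum i → f i ≡ g i
  go zero    i N≤ = far i N≤
  go (suc t) i N≤ = begin
    f i                 ≡⟨ ℕ.m∸n+n≡m (nf≤f i) ⟨
    peak f i + next f i ≡⟨ cong₂ _+_ (e i) (next-cong i λ j p → go t j
                             (subst (N ≤_) (trans (sym (ℕ.+-suc t _)) (cong (λ s → t + s) (sym p))) N≤)) ⟩
    peak g i + next g i ≡⟨ ℕ.m∸n+n≡m (ng≤g i) ⟩
    g i                 ∎

peak-nonzero : ∀ {d} (f : Vec ℕ d → ℕ) i → peak f i ≢ 0 → f i ≢ 0
peak-nonzero f i nz fi≡0 = nz (trans (cong (_∸ next f i) fi≡0) (ℕ.0∸n≡0 (next f i)))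

-- Enlarging the largest part

-- What matters is that this total order extends `≼`: enlarging the top part then keeps it on top.
lexOrder : ℕ → TotalOrder 0ℓ 0ℓ 0ℓ
lexOrder d = Lex.≤-totalOrder ℕ.≤-totalOrder _≟_ d

record IsTop {d} (a : Vec ℕ d → ℕ) (v : Vec ℕ d) : Set where
  field
    nonzero : a v ≢ 0
    largest : ∀ u → a u ≢ 0 → TotalOrder._≤_ (lexOrder d) u v

open IsTop

-- Replaces one copy of v by v ⊕ r; meaningful only when a v ≢ 0, because of the truncated subtraction.
move : ∀ {d} → (Vec ℕ d → ℕ) → Vec ℕ d → Vec ℕ d → Vec ℕ d → ℕ
move a v r u = (a u ∸ δ v u) + δ (v ⊕ r) u

module _ {d : ℕ} where

  open TotalOrder (lexOrder d) using ()
    renaming (_≤_ to _≤ₗ_; trans to ≤ₗ-trans; antisym to ≤ₗ-antisym)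
  open Extrema (lexOrder d) using (max; xs≤max; argmax-all)

  ≼⇒≤ₗ : ∀ {m} {v w : Vec ℕ m} → v ≼ w → TotalOrder._≤_ (lexOrder m) v w
  ≼⇒≤ₗ []                       = Lex.base _
  ≼⇒≤ₗ (_∷_ {x = x} {y = y} p ps) with x ≟ y
  ... | yes x≡y = Lex.next x≡y (≼⇒≤ₗ ps)
  ... | no  x≢y = Lex.this (p , x≢y) refl

  top-exists : ∀ {a : Vec ℕ d → ℕ} {b i} → (∀ u → a u ≢ 0 → u ≺ b) → a i ≢ 0 → ∃ (IsTop a)
  -- The default of `max` is itself in the support, so the maximum is too.
  top-exists {a} {b} {i} inside ai≢0 = max i support , record
    { nonzero = argmax-all id ai≢0 (All.all-filter nonzero? (box b))
    ; largest = λ u au≢0 → All.lookup (xs≤max i support)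
        (∈-filter⁺ nonzero? (∈-box⁺ (inside u au≢0)) au≢0)
    }
    where
    nonzero? = λ u → ¬? (a u ≟ 0)
    support  = filter nonzero? (box b)

  top-unique : ∀ {a b : Vec ℕ d → ℕ} {v w} → a ≗ b → IsTop a v → IsTop b w → v ≡ w
  top-unique {v = v} {w} a≗b tv tw = Pointwise.Pointwise-≡⇒≡ (≤ₗ-antisym
    (largest tw v (λ z → nonzero tv (trans (a≗b v) z)))
    (largest tv w (λ z → nonzero tw (trans (sym (a≗b w)) z))))

  move-nonzero : ∀ a v r u → move {d} a v r u ≢ 0 → u ≡ v ⊕ r ⊎ a u ≢ 0
  move-nonzero a v r u nz with u ≟ᵛ v ⊕ r
  ... | yes e = inj₁ e
  ... | no  _ = inj₂ λ z → nz
    (trans (ℕ.+-identityʳ _) (trans (cong (_∸ δ v u) z) (ℕ.0∸n≡0 (δ v u))))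

  -- Every old part is at most `v`, hence at most `v ⊕ r`, so the enlarged part can be recognised in
  -- the result.
  move-top : ∀ {a v} r → IsTop a v → IsTop (move a v r) (v ⊕ r)
  move-top {a} {v} r t = record { nonzero = nz ; largest = lg }
    where
    nz : move a v r (v ⊕ r) ≢ 0
    nz z with () ← trans (sym (δ-diagonal (v ⊕ r))) (ℕ.m+n≡0⇒n≡0 (a (v ⊕ r) ∸ δ v (v ⊕ r)) z)
    lg : ∀ u → move a v r u ≢ 0 → u ≤ₗ v ⊕ r
    lg u nz with move-nonzero a v r u nz
    ... | inj₁ refl = ≼⇒≤ₗ ≼-refl
    ... | inj₂ au≢0 = ≤ₗ-trans (largest t u au≢0) (≼⇒≤ₗ (v≼v⊕r v r))

  δ≤ : ∀ {a : Vec ℕ d → ℕ} {v} → a v ≢ 0 → ∀ u → δ v u ≤ a u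
  δ≤ {v = v} av≢0 u with u ≟ᵛ v
  ... | yes refl = ℕ.n≢0⇒n>0 av≢0
  ... | no _     = z≤n

  -- An additive form free of truncated subtraction, suited to cancelling and summing.
  move-balance : ∀ {a v} r → IsTop a v → ∀ u → move a v r u + δ v u ≡ a u + δ (v ⊕ r) u
  move-balance {a} {v} r t u = begin
    (a u ∸ δ v u) + δ (v ⊕ r) u + δ v u   ≡⟨ swap (a u ∸ δ v u) (δ (v ⊕ r) u) (δ v u) ⟩
    (a u ∸ δ v u) + δ v u + δ (v ⊕ r) u   ≡⟨ cong (_+ δ (v ⊕ r) u) (ℕ.m∸n+n≡m (δ≤ (nonzero t) u)) ⟩
    a u + δ (v ⊕ r) u                     ∎
    where
    open ≡-Reasoning
    swap : ∀ x y z → x + y + z ≡ x + z + y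
    swap = solve-∀

  -- Equal results have equal tops `v ⊕ r` and `w ⊕ r`, so `v` equals `w`, and the unit masses
  -- cancel from the balance equations.
  move-injective : ∀ {a b v w} r → IsTop a v → IsTop b w → move a v r ≗ move b w r → a ≗ b
  move-injective {a} {b} {v} {w} r tv tw e u
    with refl ← ⊕-cancelʳ r (top-unique e (move-top r tv) (move-top r tw)) =
    ℕ.+-cancelʳ-≡ (δ (v ⊕ r) u) (a u) (b u) (begin
      a u + δ (v ⊕ r) u      ≡⟨ move-balance r tv u ⟨
      move a v r u + δ v u   ≡⟨ cong (_+ δ v u) (e u) ⟩
      move b v r u + δ v u   ≡⟨ move-balance r tw u ⟩
      b u + δ (v ⊕ r) u      ∎)
    where open ≡-Reasoning

-- The array index u, counted from 0, stands for the part Vec.map suc u.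
weight : ∀ {d} → Vec ℕ d → Fin d → (Vec ℕ d → ℕ) → ℕ
weight b k a = sumBox b (λ u → a u * lookup (Vec.map suc u) k)

-- The balance equation is summed against the `k`-th coordinate `g`; adding `g v` on both sides
-- avoids subtraction.
move-weight : ∀ {d b} {a : Vec ℕ d → ℕ} {v} r k → IsTop a v → v ≺ b → v ⊕ r ≺ b →
  weight b k (move a v r) ≡ weight b k a + lookup r k
move-weight {b = b} {a} {v} r k t v≺b vr≺b = ℕ.+-cancelʳ-≡ (g v) _ _ (begin
  weight b k (move a v r) + g v                       ≡⟨ with-δ (move a v r) v v≺b ⟨
  sumBox b (λ u → (move a v r u + δ v u) * g u)       ≡⟨ cong sum
    (List.map-cong (λ u → cong (_* g u) (move-balance r t u)) (box b)) ⟩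
  sumBox b (λ u → (a u + δ (v ⊕ r) u) * g u)          ≡⟨ with-δ a (v ⊕ r) vr≺b ⟩
  weight b k a + g (v ⊕ r)                            ≡⟨ cong (λ s → weight b k a + s) g-⊕ ⟩
  weight b k a + (lookup r k + g v)                   ≡⟨ ℕ.+-assoc (weight b k a) _ _ ⟨
  weight b k a + lookup r k + g v                     ∎)
  where
  open ≡-Reasoning
  g : Vec ℕ _ → ℕ
  g u = lookup (Vec.map suc u) k
  g-⊕ : g (v ⊕ r) ≡ lookup r k + g v
  g-⊕ = trans (cong (λ w → lookup w k) (map-suc-⊕ v r))
    (trans (Vec.lookup-zipWith _+_ k (Vec.map suc v) r) (ℕ.+-comm (g v) _))
  with-δ : ∀ c w → w ≺ b → sumBox b (λ u → (c u + δ w u) * g u) ≡ weight b k c + g w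
  with-δ c w w≺b = begin
    sumBox b (λ u → (c u + δ w u) * g u)                ≡⟨ cong sum
      (List.map-cong (λ u → ℕ.*-distribʳ-+ (g u) (c u) (δ w u)) (box b)) ⟩
    sumBox b (λ u → c u * g u + δ w u * g u)            ≡⟨ sum-map-+ _ _ (box b) ⟩
    weight b k c + sumBox b (λ u → δ w u * g u)         ≡⟨ cong (λ s → weight b k c + s) (sumBox-δ g w≺b) ⟩
    weight b k c + g w                                  ∎

-- Coefficients of the product as numbers of solutions

-- Folded from the right so that it unfolds in step with `solutions`.
combination : ∀ {A : Set} {d} → (A → ℕ) → (A → Vec ℕ d) → List A → Vec ℕ d
combination c p = foldr (λ x s → Vec.map (c x *_) (p x) ⊕ s) (replicate _ 0)

lookup-combination : ∀ {A : Set} {d} (c : A → ℕ) (p : A → Vec ℕ d) k xs →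
  lookup (combination c p xs) k ≡ sum (List.map (λ x → c x * lookup (p x) k) xs)
lookup-combination c p k []       = Vec.lookup-replicate k 0
lookup-combination c p k (x ∷ xs) = trans (Vec.lookup-zipWith _+_ k (Vec.map (c x *_) (p x)) _)
  (cong₂ _+_ (Vec.lookup-map k (c x *_) (p x)) (lookup-combination c p k xs))

-- The very decision whose indicator is `geometric`, so that counts of solutions match coefficients
-- definitionally.
multiple? : ∀ {d} (i k : Vec ℕ d) → Dec (IsMultiple i k)
multiple? i k = any? (λ c → k ≟ᵛ Vec.map (c *_) i) (upTo (suc (Vec.sum k)))

multiplier-unique : ∀ {d} .{{_ : NonZero d}} {i : Vec ℕ d} → VAll.All (1 ≤_) i →
  ∀ {c c′} → Vec.map (c *_) i ≡ Vec.map (c′ *_) i → c ≡ c′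
multiplier-unique {i = suc x ∷ _} (_ ∷ _) e = ℕ.*-cancelʳ-≡ _ _ (suc x) (Vec.∷-injectiveˡ e)

prefix : ∀ {d} {i k : Vec ℕ d} → Dec (IsMultiple i k) → List (List ℕ) → List (List ℕ)
prefix (yes c·i) css = List.map (proj₁ (satisfied c·i) ∷_) css
prefix (no _)    css = []

-- The lists (c₁,…,c_N) with c₁ i₁ + … + c_N i_N = m, where is = i₁ ∷ … ∷ i_N ∷ [].
solutions : ∀ {d} → List (Vec ℕ d) → Vec ℕ d → List (List ℕ)
solutions []       m = if does (m ≟ᵛ replicate _ 0) then [] ∷ [] else []
solutions (i ∷ is) m = concatMap (λ k → prefix (multiple? i k) (solutions is (zipWith _∸_ m k)))
  (box (Vec.map suc m))

length-prefix : ∀ {d} {i k : Vec ℕ d} (c·i? : Dec (IsMultiple i k)) css →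
  + length (prefix c·i? css) ≡ indicator c·i? ℤ.* + length css
length-prefix (yes c·i) css = trans (cong +_ (List.length-map _ css)) (sym (ℤ.*-identityˡ _))
length-prefix (no _)    css = refl

length-concatMap : ∀ {A B : Set} (f : A → List B) xs →
  + length (concatMap f xs) ≡ sumℤ (List.map (λ x → + length (f x)) xs)
length-concatMap f []       = refl
length-concatMap f (x ∷ xs) = trans (cong +_ (List.length-++ (f x)))
  (trans (ℤ.pos-+ (length (f x)) _) (cong (λ s → + length (f x) ℤ.+ s) (length-concatMap f xs)))

-- Each `k` splits `m` into a candidate multiple of `i` and a remainder, so the lengths add up as in
-- the convolution `⊛`.
length-solutions : ∀ {d} (is : List (Vec ℕ d)) m → + length (solutions is m) ≡ ∏ geometric is m
length-solutions []       m with m ≟ᵛ replicate _ 0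
... | yes _ = refl
... | no  _ = refl
length-solutions (i ∷ is) m = trans
  (length-concatMap (λ k → prefix (multiple? i k) (solutions is (zipWith _∸_ m k)))
    (box (Vec.map suc m)))
  (sumℤ-cong {xs = box (Vec.map suc m)} λ {k} _ → trans
    (length-prefix (multiple? i k) (solutions is (zipWith _∸_ m k)))
    (cong (geometric i k ℤ.*_) (length-solutions is (zipWith _∸_ m k))))

∈-prefix : ∀ {d} .{{_ : NonZero d}} {i : Vec ℕ d} {c cs css} → VAll.All (1 ≤_) i →
  (c·i? : Dec (IsMultiple i (Vec.map (c *_) i))) → cs ∈ css → c ∷ cs ∈ prefix c·i? css
∈-prefix {c = c} pos (no ¬c·i) cs∈ = contradiction (multiple⁺ pos c refl) ¬c·i
∈-prefix {c = c} {cs} {css} pos (yes c·i) cs∈ =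
  -- The search returns some multiplier; by uniqueness it is `c`.
  subst (λ c′ → c ∷ cs ∈ List.map (c′ ∷_) css)
    (multiplier-unique pos {c} (proj₂ (satisfied c·i))) (∈-map⁺ (c ∷_) cs∈)

-- In the convolution, take the split at `c x` times `p x`; the remainder is the combination of the
-- other vectors.
∈-solutions : ∀ {A : Set} {d} .{{_ : NonZero d}} (c : A → ℕ) (p : A → Vec ℕ d) →
  (∀ x → VAll.All (1 ≤_) (p x)) → ∀ xs →
  List.map c xs ∈ solutions (List.map p xs) (combination c p xs)
∈-solutions {d = d} c p pos [] with replicate d 0 ≟ᵛ replicate d 0
... | yes _  = here refl
... | no 0≢0 = contradiction refl 0≢0
∈-solutions {d = d} c p pos (x ∷ xs) = ∈-concatMap⁺ _ (lose (∈-box⁺ (≼⇒≺suc (v≼v⊕r k s)))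
  (∈-prefix (pos x) (multiple? (p x) k)
    (subst (λ m → List.map c xs ∈ solutions (List.map p xs) m)
      (sym (⊕-∸-cancelˡ k s)) (∈-solutions c p pos xs))))
  where
  k = Vec.map (c x *_) (p x)
  s = combination c p xs

-- Lists and cardinalities

map-≡⇒≡ : ∀ {A B : Set} {f g : A → B} {xs x} → List.map f xs ≡ List.map g xs → x ∈ xs → f x ≡ g x
map-≡⇒≡ {xs = _ ∷ _} e (here refl) = List.∷-injectiveˡ e
map-≡⇒≡ {xs = _ ∷ _} e (there x∈)  = map-≡⇒≡ (List.∷-injectiveʳ e) x∈

length-cartesianProductWith : ∀ {A B C : Set} (f : A → B → C) xs ys →
  length (cartesianProductWith f xs ys) ≡ length xs * length ys
length-cartesianProductWith f []       ys = refl
length-cartesianProductWith f (x ∷ xs) ys = trans (List.length-++ (List.map (f x) ys))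
  (cong₂ _+_ (List.length-map (f x) ys) (length-cartesianProductWith f xs ys))

length-cube : ∀ d n → length (box (replicate d n)) ≡ n ^ d
length-cube zero    n = refl
length-cube (suc d) n = trans (length-cartesianProductWith _∷_ (upTo n) (box (replicate d n)))
  (cong₂ _*_ (List.length-upTo n) (length-cube d n))

-- Sending an element to the position of its code embeds `Fin k` into `Fin (length ys)`, as equal
-- positions hold equal codes.
cardinality-≤ : ∀ {S : Setoid 0ℓ 0ℓ} {k} {A : Set} {ys : List A} → HasCardinality S k →
  (code : Setoid.Carrier S → A) → (∀ x → code x ∈ ys) →
  (∀ x y → code x ≡ code y → Setoid._≈_ S x y) → k ≤ length ys
cardinality-≤ S↔k code code∈ code-injective = injective⇒≤ λ {i} {j} e →
  Bijection.injective S↔k (code-injective _ _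
    (index-injective (setoid _) (code∈ (Bijection.to S↔k i)) (code∈ (Bijection.to S↔k j)) e))

suc-positive : ∀ {d} (u : Vec ℕ d) → VAll.All (1 ≤_) (Vec.map suc u)
suc-positive []      = []
suc-positive (_ ∷ u) = s≤s z≤n ∷ suc-positive u

-- The injective encoding of partitions

module Encoding (d n : ℕ) .{{_ : NonZero d}} .{{_ : NonZero n}} where

  open Setoid (PartitionsOfVolume d n) using (Carrier; _≈_)

  corner : Vec ℕ d
  corner = replicate d n

  module _ (π : Partition d) where

    private
      f = entry π
      a = peak f

    next-entry-≤ : ∀ i → next f i ≤ f i
    next-entry-≤ = next-≤ (antitone π)

    peak-step : ∀ k i → a i + f (updateAt i k suc) ≤ f i
    peak-step k i = ℕ.≤-trans (ℕ.+-monoʳ-≤ (a i) (step≤next f i k))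
      (ℕ.≤-reflexive (ℕ.m∸n+n≡m (next-entry-≤ i)))

    module _ (vπ : volume π ≡ n) where

      entry-inside : ∀ i → f i ≢ 0 → i ≺ corner
      entry-inside i nz = subst (λ n → i ≺ replicate d n) vπ (finite-by-volume π i nz)

      peak-inside : ∀ i → a i ≢ 0 → i ≺ corner
      peak-inside i nz = entry-inside i (peak-nonzero f i nz)

      -- Indices in the cube have coordinate sum at most that of `corner`; this supplies the base
      -- level for `peak-determines`.
      entry-far : ∀ i → suc (Vec.sum corner) ≤ Vec.sum i → f i ≡ 0
      entry-far i far with f i ≟ 0
      ... | yes z = z
      ... | no nz = contradiction (≼⇒sum≤ (Pointwise.map ℕ.<⇒≤ (entry-inside i nz))) (ℕ.<⇒≱ far)

      weight-peak-≤ : ∀ k → weight corner k a ≤ n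
      weight-peak-≤ k = ℕ.≤-trans (sumBox-by-parts corner k (peak-step k)) (ℕ.≤-reflexive
        -- Both boxes contain the support, so the sum over the cube is the volume.
        (trans (sumBox-cong corner (bound π) (λ _ → refl) entry-inside (finite π)) vπ))

      -- Without peaks, `π` would have the same peaks as the zero array, hence be zero, against
      -- `n ≥ 1`.
      has-peak : ∃ λ i → a i ≢ 0
      has-peak with sumBox corner a ≟ 0
      ... | no nz = sumBox≢0 corner a nz
      ... | yes z = contradiction (trans (sym vπ) volume≡0) (≢-nonZero⁻¹ n)
        where
        no-peak : ∀ i → a i ≡ 0
        no-peak i with a i ≟ 0
        ... | yes z′ = z′
        ... | no nz  = ℕ.n≤0⇒n≡0 (subst (a i ≤_) z (≤-sumBox corner a (peak-inside i nz)))
        flat : f ≗ λ _ → 0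
        flat = peak-determines (suc (Vec.sum corner)) entry-far next-entry-≤
          (next-≤ (λ _ → z≤n)) (λ i → trans (no-peak i) (sym (ℕ.0∸n≡0 (next (λ _ → 0) i))))
        volume≡0 : volume π ≡ 0
        volume≡0 = sum-map-0 {xs = box (bound π)} (All.tabulate λ {i} _ → flat i)

      top : ∃ (IsTop a)
      top = top-exists {i = proj₁ has-peak} peak-inside (proj₂ has-peak)

      private
        v = proj₁ top

      -- The vector `r` of the overview; the subtraction is exact by `weight-peak-≤`.
      deficit : Vec ℕ d
      deficit = zipWith _∸_ corner (combination a (Vec.map suc) (box corner))

      completed : Vec ℕ d → ℕ
      completed = move a v deficit

      lookup-deficit : ∀ k → lookup deficit k ≡ n ∸ weight corner k a
      lookup-deficit k = trans (Vec.lookup-zipWith _∸_ k corner _)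
        (cong₂ _∸_ (Vec.lookup-replicate k n) (lookup-combination a (Vec.map suc) k (box corner)))

      v-inside : v ≺ corner
      v-inside = peak-inside v (nonzero (proj₂ top))

      -- A single copy of the part `v`, with coordinates counted from 1, already contributes this
      -- much.
      top-weight : ∀ k → suc (lookup v k) ≤ weight corner k a
      top-weight k = begin
        suc (lookup v k)                   ≡⟨ Vec.lookup-map k suc v ⟨
        lookup (Vec.map suc v) k           ≤⟨ ℕ.m≤n*m _ (a v) {{≢-nonZero (nonzero (proj₂ top))}} ⟩
        a v * lookup (Vec.map suc v) k     ≤⟨ ≤-sumBox corner _ v-inside ⟩
        weight corner k a                  ∎
        where open ℕ.≤-Reasoning

      deficit-inside : deficit ≺ corner
      deficit-inside = Pointwise⁺ λ k → subst₂ _<_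
        (sym (lookup-deficit k)) (sym (Vec.lookup-replicate k n))
        -- Strict because `m_k ≥ 1`; this leaves `n` rather than `n + 1` values per coordinate.
        (ℕ.∸-monoʳ-< {n} (ℕ.≤-trans (s≤s z≤n) (top-weight k)) (weight-peak-≤ k))

      -- As `v` is one of the parts of `m`, its enlargement is bounded by `m + r = (n,…,n)`, so the
      -- cube still lists every part.
      moved-inside : v ⊕ deficit ≺ corner
      moved-inside = Pointwise⁺ λ k → begin-strict
        lookup (v ⊕ deficit) k                       ≡⟨ Vec.lookup-zipWith _+_ k v deficit ⟩
        lookup v k + lookup deficit k                <⟨ ℕ.+-monoˡ-≤ _ (top-weight k) ⟩
        weight corner k a + lookup deficit k         ≡⟨ cong (λ s → weight corner k a + s) (lookup-deficit k) ⟩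
        weight corner k a + (n ∸ weight corner k a)  ≡⟨ ℕ.m+[n∸m]≡n (weight-peak-≤ k) ⟩
        n                                            ≡⟨ Vec.lookup-replicate k n ⟨
        lookup corner k                              ∎
        where open ℕ.≤-Reasoning

      completed-inside : ∀ u → completed u ≢ 0 → u ≺ corner
      completed-inside u nz with move-nonzero a v deficit u nz
      ... | inj₁ refl = moved-inside
      ... | inj₂ au≢0 = peak-inside u au≢0

      combination-completed : combination completed (Vec.map suc) (box corner) ≡ corner
      combination-completed = Pointwise.Pointwise-≡⇒≡ (Pointwise⁺ λ k → begin
        lookup (combination completed (Vec.map suc) (box corner)) k
                                                     ≡⟨ lookup-combination completed (Vec.map suc) k (box corner) ⟩
        weight corner k completed                    ≡⟨ move-weight deficit k (proj₂ top) v-inside moved-inside ⟩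
        weight corner k a + lookup deficit k         ≡⟨ cong (λ s → weight corner k a + s) (lookup-deficit k) ⟩
        weight corner k a + (n ∸ weight corner k a)  ≡⟨ ℕ.m+[n∸m]≡n (weight-peak-≤ k) ⟩
        n                                            ≡⟨ Vec.lookup-replicate k n ⟨
        lookup corner k                              ∎)
        where open ≡-Reasoning

  code : Carrier → Vec ℕ d × List ℕ
  code (π , vπ) = deficit π vπ , List.map (completed π vπ) (box corner)

  codes : List (Vec ℕ d × List ℕ)
  codes = cartesianProduct (box corner) (solutions (positiveBox corner) corner)

  code∈ : ∀ π → code π ∈ codes
  code∈ (π , vπ) = ∈-cartesianProduct⁺ (∈-box⁺ (deficit-inside π vπ))
    (subst (λ m → List.map (completed π vπ) (box corner) ∈ solutions (positiveBox corner) m)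
      (combination-completed π vπ)
      (∈-solutions (completed π vπ) (Vec.map suc) suc-positive (box corner)))

  -- The construction is undone backwards: the lists give the completed arrays, the common deficit
  -- undoes the move, and the peaks give the entries.
  code-injective : ∀ π ρ → code π ≡ code ρ → π ≈ ρ
  code-injective (π , vπ) (ρ , vρ) e = peak-determines (suc (Vec.sum corner))
    (λ i far → trans (entry-far π vπ i far) (sym (entry-far ρ vρ i far)))
    (next-entry-≤ π) (next-entry-≤ ρ)
    (move-injective (deficit π vπ) (proj₂ (top π vπ)) (proj₂ (top ρ vρ)) λ u →
      trans (completed≗ u)
        -- `move-injective` takes one common shift, so the deficit of `ρ` is replaced by that of
        -- `π`.
        (cong (λ r → move (peak (entry ρ)) (proj₁ (top ρ vρ)) r u) (sym (cong proj₁ e))))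
    where
    completed≗ : completed π vπ ≗ completed ρ vρ
    -- The lists compare values in the cube only; wherever either array is nonzero, `u` lies in it.
    completed≗ u with completed π vπ u ≟ 0 | completed ρ vρ u ≟ 0
    ... | yes z | yes z′ = trans z (sym z′)
    ... | no nz | _      = map-≡⇒≡ (cong proj₂ e) (∈-box⁺ (completed-inside π vπ u nz))
    ... | _     | no nz  = map-≡⇒≡ (cong proj₂ e) (∈-box⁺ (completed-inside ρ vρ u nz))

theorem1p2 : (d n : ℕ) .{{_ : NonZero d}} .{{_ : NonZero n}} →
    partitionNumber d n ≤ n ^ d * vectorPartitionNumber (replicate d n)
theorem1p2 d n = ℕ.≤-trans
  (cardinality-≤ (proj₂ (partitions-finite d n)) code code∈ code-injective)
  (ℕ.≤-reflexive (trans (length-cartesianProductWith _,_ (box corner) _)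
    -- `vectorPartitionNumber` unfolds to the absolute value of this coefficient of the finite
    -- product.
    (cong₂ _*_ (length-cube d n) (cong ℤ.∣_∣ (length-solutions (positiveBox corner) corner)))))
  where open Encoding d n
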